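{- Let $n\geqslant 3$ and $r$ be integers. If there exists an $r$-regular maximal $(2,3)$-antichain on $n$ points, then $r\geqslant \frac{5n-9}{6}$.
   Context: Let $[n]=\{1,2,\ldots,n\}$. A maximal $(2,3)$-antichain on $n$ points is a family $\mathcal{A}=\mathcal{A}_2\cup\mathcal{A}_3$ with $\mathcal{A}_2\subseteq\binom{[n]}{2}$ (2-element subsets) and $\mathcal{A}_3\subseteq\binom{[n]}{3}$ (3-element subsets) such that (1) no member of $\mathcal{A}$ is a subset of another member of $\mathcal{A}$, and (2) for every $X\in 2^{[n]}\setminus\mathcal{A}$ there is an $A\in\mathcal{A}$ with $X\subseteq A$ or $A\subseteq X$. It is $r$-regular if every element of $[n]$ is contained in exactly $r$ members of $\mathcal{A}$. -}

module Defs where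

open import Data.Fin.Base using (Fin)
open import Data.Fin.Subset using (Subset; _∈_; _⊆_; _⊈_; ∣_∣)
open import Data.Fin.Subset.Properties using (_∈?_)
open import Data.Integer.Base using (ℤ; +_)
open import Data.List.Base using (List; filter; length)
import Data.List.Membership.Propositional as List
open import Data.List.Relation.Unary.Unique.Propositional using (Unique)
open import Data.Nat.Base using (ℕ)
open import Data.Product.Base using (∃-syntax; _×_)
open import Data.Sum.Base using (_⊎_)
open import Relation.Binary.PropositionalEquality.Core using (_≡_; _≢_)
open import Relation.Nullary.Negation.Core using (¬_)

-- A set of subsets of the n-element ground set Fin n, given by a
-- duplicate-free enumeration, so that counting list entries counts members.
record Family (n : ℕ) : Set where
  field
    members : List (Subset n)
    unique  : Unique members

open Family public

infix 4 _∈ᶠ_ _∉ᶠ_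

_∈ᶠ_ : ∀ {n} → Subset n → Family n → Set
A ∈ᶠ 𝒜 = A List.∈ members 𝒜

_∉ᶠ_ : ∀ {n} → Subset n → Family n → Set
A ∉ᶠ 𝒜 = ¬ (A ∈ᶠ 𝒜)

-- The subfamilies 𝒜₂ and 𝒜₃ are determined by 𝒜, as its members of size 2
-- and of size 3; either may be empty.
record IsMaximal23Antichain {n : ℕ} (𝒜 : Family n) : Set where
  field
    sizes     : ∀ A → A ∈ᶠ 𝒜 → ∣ A ∣ ≡ 2 ⊎ ∣ A ∣ ≡ 3
    antichain : ∀ A B → A ∈ᶠ 𝒜 → B ∈ᶠ 𝒜 → A ≢ B → A ⊈ B
    maximal   : ∀ X → X ∉ᶠ 𝒜 → ∃[ A ] A ∈ᶠ 𝒜 × (X ⊆ A ⊎ A ⊆ X)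

degree : ∀ {n} → Family n → Fin n → ℕ
degree 𝒜 x = length (filter (x ∈?_) (members 𝒜))

IsRegular : ∀ {n} → ℤ → Family n → Set
IsRegular r 𝒜 = ∀ x → + degree 𝒜 x ≡ r

{-# OPTIONS --safe #-}

-- Let G be the graph of pairs outside 𝒜. The triples of 𝒜 are the triangles
-- of G, and maximality puts every edge of G in a triangle. With d x the degree
-- of x in G and w x y the number of common neighbours of an edge, counting
-- pairs (A , y) with x , y ∈ A gives
--   2 r ≥ 2 (n - 1) - d x + Σ (w x y - 1),   y ranging over the neighbours of x.
-- An isolated x already gives r ≥ n - 1. Otherwise add these bounds over the
-- vertices of one triangle x y z, keeping on the right only the edges of that
-- triangle (each appears twice), and bound d x + d y + d z by
-- n + w x y + w x z + w y z.
module Submission where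

open import Defs
import Algebra.Properties.Semiring.Sum
open import Data.Bool.Base using (true; false; _∧_; if_then_else_)
import Data.Bool.Properties as Bool
open import Data.Empty using (⊥-elim)
open import Data.Fin.Base using (Fin; zero; suc)
import Data.Fin.Properties as Fin
open import Data.Fin.Subset
  using (Subset; _∈_; _∉_; _⊆_; ∣_∣; ⁅_⁆; _∪_; _∩_; inside; outside)
  renaming (_-_ to infixl 5 _∖_)
open import Data.Fin.Subset.Properties
open import Data.Integer.Base using (ℤ; +_; _*_; _-_)
import Data.Integer.Base as ℤ
import Data.Integer.Properties as ℤₚ
open import Data.List.Base using (List; []; _∷_; filter; length; map)
open import Data.List.Membership.Propositional using () renaming (_∈_ to _∈ₗ_)
open import Data.List.Membership.Propositional.Properties using (∈-filter⁺; ∈-filter⁻)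
import Data.List.Membership.DecPropositional as DecMembership
open import Data.List.Relation.Unary.All using (All; []; _∷_; tabulate)
open import Data.List.Relation.Unary.Any using (here; there)
open import Data.Nat.Base using (ℕ; _∸_; z≤n; s≤s; pred) renaming (_≥_ to _≥ℕ_)
import Data.Nat.Base as ℕ
open import Data.Nat.ListAction using (sum)
import Data.Nat.Properties as ℕₚ
open import Data.Nat.Tactic.RingSolver using (solve-∀)
open import Data.Product.Base using (∃-syntax; _×_; _,_; proj₁)
open import Data.Rational.Base using (_/_; _≥_)
import Data.Rational.Base as ℚ
import Data.Rational.Properties as ℚₚ
import Data.Rational.Unnormalised.Base as ℚᵘ
import Data.Rational.Unnormalised.Properties as ℚᵘₚ
open import Data.Sum.Base using (_⊎_; inj₁; inj₂; [_,_]′)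
import Data.Vec.Base as Vec
open import Data.Vec.Base using ([]; _∷_; lookup)
import Data.Vec.Properties as Vec
open import Function.Base using (_∘_)
open import Relation.Binary.PropositionalEquality
  using (_≡_; _≢_; refl; sym; trans; cong; cong₂; subst; subst₂)
open import Relation.Nullary using (Dec; yes; no; does; ¬_)
open import Relation.Nullary.Decidable using (_×-dec_; ¬?; dec-true; decidable-stable)

open Algebra.Properties.Semiring.Sum ℕₚ.+-*-semiring
  using (sum-syntax; ∑-distrib-+; *-distribʳ-sum; *-distribˡ-sum)
  renaming (sum to ∑)

private variable
  n : ℕ
  A B : Subset n

-- Sums over finite index sets and over lists

∑-mono-≤ : (f g : Fin n → ℕ) → (∀ i → f i ℕ.≤ g i) → ∑ f ℕ.≤ ∑ g
∑-mono-≤ {ℕ.zero} f g f≤g = z≤n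
∑-mono-≤ {ℕ.suc _} f g f≤g =
  ℕₚ.+-mono-≤ (f≤g zero) (∑-mono-≤ (f ∘ suc) (g ∘ suc) (f≤g ∘ suc))

∑-const : ∀ n c → ∑[ i < n ] c ≡ n ℕ.* c
∑-const ℕ.zero c = refl
∑-const (ℕ.suc n) c = cong (c ℕ.+_) (∑-const n c)

term≤∑ : (f : Fin n → ℕ) (i : Fin n) → f i ℕ.≤ ∑ f
term≤∑ f zero = ℕₚ.m≤m+n _ _
term≤∑ f (suc i) = ℕₚ.≤-trans (term≤∑ (f ∘ suc) i) (ℕₚ.m≤n+m _ _)

two-terms≤∑ : (f : Fin n → ℕ) {i j : Fin n} → i ≢ j → f i ℕ.+ f j ℕ.≤ ∑ f
two-terms≤∑ f {zero} {zero} i≢j = ⊥-elim (i≢j refl)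
two-terms≤∑ f {zero} {suc j} i≢j = ℕₚ.+-monoʳ-≤ (f zero) (term≤∑ (f ∘ suc) j)
two-terms≤∑ f {suc i} {zero} i≢j =
  subst (ℕ._≤ ∑ f) (ℕₚ.+-comm (f zero) (f (suc i)))
    (ℕₚ.+-monoʳ-≤ (f zero) (term≤∑ (f ∘ suc) i))
two-terms≤∑ f {suc i} {suc j} i≢j =
  ℕₚ.≤-trans (two-terms≤∑ (f ∘ suc) (i≢j ∘ cong suc)) (ℕₚ.m≤n+m _ _)

term≤sum : {X : Set} (f : X → ℕ) {a : X} {as : List X} → a ∈ₗ as → f a ℕ.≤ sum (map f as)
term≤sum f (here refl) = ℕₚ.m≤m+n _ _
term≤sum f (there a∈as) = ℕₚ.≤-trans (term≤sum f a∈as) (ℕₚ.m≤n+m _ _)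

-- Double counting as an inequality: after exchanging the two sums, it suffices to bound the total
-- contribution of each list entry.
∑-sum-swap-≤ : {X : Set} (f : Fin n → X → ℕ) (g : X → ℕ) (as : List X) →
  All (λ a → ∑[ i < n ] f i a ℕ.≤ g a) as →
  ∑[ i < n ] sum (map (f i) as) ℕ.≤ sum (map g as)
∑-sum-swap-≤ {n} f g [] [] = ℕₚ.≤-reflexive (trans (∑-const n 0) (ℕₚ.*-zeroʳ n))
∑-sum-swap-≤ f g (a ∷ as) (p ∷ ps) =
  subst (ℕ._≤ _) (sym (∑-distrib-+ (λ i → f i a) (λ i → sum (map (f i) as))))
    (ℕₚ.+-mono-≤ p (∑-sum-swap-≤ f g as ps))

sum-const : {X : Set} (c : ℕ) (as : List X) → sum (map (λ _ → c) as) ≡ length as ℕ.* c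
sum-const c [] = refl
sum-const c (a ∷ as) = cong (c ℕ.+_) (sum-const c as)

-- Indicator functions and cardinalities

χ : Subset n → Fin n → ℕ
χ A x = if lookup A x then 1 else 0

χ-∈ : ∀ {x} → x ∈ A → χ A x ≡ 1
χ-∈ x∈A rewrite Vec.[]=⇒lookup x∈A = refl

χ-∉ : ∀ {x} → x ∉ A → χ A x ≡ 0
χ-∉ {A = A} {x} x∉A with lookup A x in eq
... | true = ⊥-elim (x∉A (Vec.lookup⇒[]= x A eq))
... | false = refl

∑χ≡∣∣ : (A : Subset n) → ∑ (χ A) ≡ ∣ A ∣
∑χ≡∣∣ [] = refl
∑χ≡∣∣ (outside ∷ A) = ∑χ≡∣∣ A
∑χ≡∣∣ (inside ∷ A) = cong ℕ.suc (∑χ≡∣∣ A)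

-- A point lying in m of the three sets is counted m times on the left and 1 + m(m-1)/2 times on the
-- right, and m never exceeds the latter.
three-sets-bound : (p q s : Subset n) →
  ∣ p ∣ ℕ.+ ∣ q ∣ ℕ.+ ∣ s ∣ ℕ.≤ n ℕ.+ (∣ p ∩ q ∣ ℕ.+ ∣ p ∩ s ∣ ℕ.+ ∣ q ∩ s ∣)
three-sets-bound {n} p q s = begin
  ∣ p ∣ ℕ.+ ∣ q ∣ ℕ.+ ∣ s ∣
    ≡⟨ cong₂ ℕ._+_ (cong₂ ℕ._+_ (∑χ≡∣∣ p) (∑χ≡∣∣ q)) (∑χ≡∣∣ s) ⟨
  ∑ (χ p) ℕ.+ ∑ (χ q) ℕ.+ ∑ (χ s)
    ≡⟨ ∑-distrib-+³ (χ p) (χ q) (χ s) ⟨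
  ∑ (λ i → χ p i ℕ.+ χ q i ℕ.+ χ s i)
    ≤⟨ ∑-mono-≤ _ _ pointwise ⟩
  ∑ (λ i → 1 ℕ.+ (χ (p ∩ q) i ℕ.+ χ (p ∩ s) i ℕ.+ χ (q ∩ s) i))
    ≡⟨ ∑-distrib-+ {n} (λ _ → 1) _ ⟩
  ∑[ i < n ] 1 ℕ.+ ∑ (λ i → χ (p ∩ q) i ℕ.+ χ (p ∩ s) i ℕ.+ χ (q ∩ s) i)
    ≡⟨ cong₂ ℕ._+_ (trans (∑-const n 1) (ℕₚ.*-identityʳ n))
         (∑-distrib-+³ (χ (p ∩ q)) (χ (p ∩ s)) (χ (q ∩ s))) ⟩
  n ℕ.+ (∑ (χ (p ∩ q)) ℕ.+ ∑ (χ (p ∩ s)) ℕ.+ ∑ (χ (q ∩ s)))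
    ≡⟨ cong (n ℕ.+_) (cong₂ ℕ._+_ (cong₂ ℕ._+_ (∑χ≡∣∣ (p ∩ q)) (∑χ≡∣∣ (p ∩ s))) (∑χ≡∣∣ (q ∩ s))) ⟩
  n ℕ.+ (∣ p ∩ q ∣ ℕ.+ ∣ p ∩ s ∣ ℕ.+ ∣ q ∩ s ∣) ∎
  where
  open ℕₚ.≤-Reasoning
  ∑-distrib-+³ : ∀ {n} (f g h : Fin n → ℕ) →
    ∑ (λ i → f i ℕ.+ g i ℕ.+ h i) ≡ ∑ f ℕ.+ ∑ g ℕ.+ ∑ h
  ∑-distrib-+³ f g h =
    trans (∑-distrib-+ (λ i → f i ℕ.+ g i) h) (cong (ℕ._+ ∑ h) (∑-distrib-+ f g))
  pointwise : ∀ i → χ p i ℕ.+ χ q i ℕ.+ χ s i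
                ℕ.≤ 1 ℕ.+ (χ (p ∩ q) i ℕ.+ χ (p ∩ s) i ℕ.+ χ (q ∩ s) i)
  pointwise i rewrite Vec.lookup-zipWith _∧_ i p q
                    | Vec.lookup-zipWith _∧_ i p s
                    | Vec.lookup-zipWith _∧_ i q s
    with lookup p i | lookup q i | lookup s i
  ... | true  | true  | true  = s≤s (s≤s (s≤s z≤n))
  ... | true  | true  | false = s≤s (s≤s z≤n)
  ... | true  | false | true  = s≤s (s≤s z≤n)
  ... | true  | false | false = s≤s z≤n
  ... | false | true  | true  = s≤s (s≤s z≤n)
  ... | false | true  | false = s≤s z≤n
  ... | false | false | true  = s≤s z≤n
  ... | false | false | false = z≤n

-- Pairs and triples as subsets

∣∣≤⇒≡ : A ⊆ B → ∣ B ∣ ℕ.≤ ∣ A ∣ → A ≡ B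
∣∣≤⇒≡ {A = A} {B} A⊆B ∣B∣≤∣A∣ = ⊆-antisym A⊆B λ {x} x∈B →
  decidable-stable (x ∈? A) λ x∉A →
    ℕₚ.<⇒≱ (p⊂q⇒∣p∣<∣q∣ ((λ {y} → A⊆B {y}) , x , x∈B , x∉A)) ∣B∣≤∣A∣

∣A∖x∣≤k : ∀ {x k} → x ∈ A → ∣ A ∣ ≡ ℕ.suc k → ∣ A ∖ x ∣ ℕ.≤ k
∣A∖x∣≤k {A = A} {x} {k} x∈A ∣A∣≡ = ℕ.s≤s⁻¹ (subst (∣ A ∖ x ∣ ℕ.<_) ∣A∣≡ (x∈p⇒∣p-x∣<∣p∣ x∈A))

pair : Fin n → Fin n → Subset n
pair x y = ⁅ x ⁆ ∪ ⁅ y ⁆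

triple : Fin n → Fin n → Fin n → Subset n
triple x y z = ⁅ x ⁆ ∪ pair y z

pair-comm : (x y : Fin n) → pair x y ≡ pair y x
pair-comm x y = ∪-comm ⁅ x ⁆ ⁅ y ⁆

module _ {x y : Fin n} where

  ∈-pair⁻ : ∀ {u} → u ∈ pair x y → u ≡ x ⊎ u ≡ y
  ∈-pair⁻ u∈ with x∈p∪q⁻ ⁅ x ⁆ ⁅ y ⁆ u∈
  ... | inj₁ u∈x = inj₁ (x∈⁅y⁆⇒x≡y x u∈x)
  ... | inj₂ u∈y = inj₂ (x∈⁅y⁆⇒x≡y y u∈y)

  x∈pair : x ∈ pair x y
  x∈pair = x∈p∪q⁺ (inj₁ (x∈⁅x⁆ x))

  y∈pair : y ∈ pair x y
  y∈pair = x∈p∪q⁺ (inj₂ (x∈⁅x⁆ y))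

  pair⊆ : x ∈ A → y ∈ A → pair x y ⊆ A
  pair⊆ x∈A y∈A u∈ with ∈-pair⁻ u∈
  ... | inj₁ refl = x∈A
  ... | inj₂ refl = y∈A

∣⁅x⁆∪A∣ : ∀ {x} → x ∉ A → ∣ ⁅ x ⁆ ∪ A ∣ ≡ ℕ.suc ∣ A ∣
∣⁅x⁆∪A∣ {A = inside ∷ A} {zero} x∉A = ⊥-elim (x∉A Vec.here)
∣⁅x⁆∪A∣ {A = outside ∷ A} {zero} x∉A = cong (ℕ.suc ∘ ∣_∣) (∪-identityˡ A)
∣⁅x⁆∪A∣ {A = inside ∷ A} {suc x} x∉A = cong ℕ.suc (∣⁅x⁆∪A∣ (x∉A ∘ Vec.there))
∣⁅x⁆∪A∣ {A = outside ∷ A} {suc x} x∉A = ∣⁅x⁆∪A∣ (x∉A ∘ Vec.there)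

∣pair∣ : {x y : Fin n} → x ≢ y → ∣ pair x y ∣ ≡ 2
∣pair∣ {x = x} {y} x≢y =
  trans (∣⁅x⁆∪A∣ (x≢y ∘ x∈⁅y⁆⇒x≡y y)) (cong ℕ.suc (∣⁅x⁆∣≡1 y))

module _ {x y z : Fin n} where

  ∈-triple⁻ : ∀ {u} → u ∈ triple x y z → u ≡ x ⊎ u ≡ y ⊎ u ≡ z
  ∈-triple⁻ u∈ with x∈p∪q⁻ ⁅ x ⁆ (pair y z) u∈
  ... | inj₁ u∈x = inj₁ (x∈⁅y⁆⇒x≡y x u∈x)
  ... | inj₂ u∈yz = inj₂ (∈-pair⁻ u∈yz)

  x∈triple : x ∈ triple x y z
  x∈triple = x∈p∪q⁺ (inj₁ (x∈⁅x⁆ x))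

  y∈triple : y ∈ triple x y z
  y∈triple = x∈p∪q⁺ (inj₂ x∈pair)

  z∈triple : z ∈ triple x y z
  z∈triple = x∈p∪q⁺ {p = ⁅ x ⁆} (inj₂ (y∈pair {x = y}))

  ∣triple∣ : x ≢ y → x ≢ z → y ≢ z → ∣ triple x y z ∣ ≡ 3
  ∣triple∣ x≢y x≢z y≢z =
    trans (∣⁅x⁆∪A∣ λ x∈ → [ x≢y , x≢z ]′ (∈-pair⁻ x∈)) (cong ℕ.suc (∣pair∣ y≢z))

-- The graph of pairs outside the antichain

module EdgeGraph {n} (𝒜 : Family n) (max : IsMaximal23Antichain 𝒜) where

  open IsMaximal23Antichain max
  open DecMembership (Vec.≡-dec {n = n} Bool._≟_) using () renaming (_∈?_ to _∈ₗ?_)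

  infix 4 _~_ _~?_

  _~_ : Fin n → Fin n → Set
  x ~ y = x ≢ y × pair x y ∉ᶠ 𝒜

  _~?_ : ∀ x y → Dec (x ~ y)
  x ~? y = ¬? (x Fin.≟ y) ×-dec ¬? (pair x y ∈ₗ? members 𝒜)

  ~-sym : ∀ {x y} → x ~ y → y ~ x
  ~-sym {x} {y} (x≢y , xy∉) = x≢y ∘ sym , subst (_∉ᶠ 𝒜) (pair-comm x y) xy∉

  2≤∣∣ : A ∈ᶠ 𝒜 → 2 ℕ.≤ ∣ A ∣
  2≤∣∣ A∈ with sizes _ A∈
  ... | inj₁ eq = ℕₚ.≤-reflexive (sym eq)
  ... | inj₂ eq = ℕₚ.≤-trans (s≤s (s≤s z≤n)) (ℕₚ.≤-reflexive (sym eq))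

  ∣∣≤3 : A ∈ᶠ 𝒜 → ∣ A ∣ ℕ.≤ 3
  ∣∣≤3 A∈ with sizes _ A∈
  ... | inj₁ eq = ℕₚ.≤-trans (ℕₚ.≤-reflexive eq) (s≤s (s≤s z≤n))
  ... | inj₂ eq = ℕₚ.≤-reflexive eq

  -- A 2-element member containing both ends of an edge would be that edge, which lies outside `𝒜`.
  edge⊈ : ∀ {x y} → x ~ y → A ∈ᶠ 𝒜 → ∣ A ∣ ≡ 2 → x ∈ A → y ∉ A
  edge⊈ (x≢y , xy∉) A∈ ∣A∣≡2 x∈A y∈A = xy∉ (subst (_∈ᶠ 𝒜) (sym pair≡A) A∈)
    where pair≡A = ∣∣≤⇒≡ (pair⊆ x∈A y∈A) (ℕₚ.≤-reflexive (trans ∣A∣≡2 (sym (∣pair∣ x≢y))))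

  ⊆-singleton⊥ : ∀ {x} → A ∈ᶠ 𝒜 → ¬ A ⊆ ⁅ x ⁆
  ⊆-singleton⊥ {x = x} A∈ A⊆ = ℕₚ.<⇒≱ (2≤∣∣ A∈)
    (ℕₚ.≤-trans (p⊆q⇒∣p∣≤∣q∣ A⊆) (ℕₚ.≤-reflexive (∣⁅x⁆∣≡1 x)))

  -- Once one vertex of the triangle is known to lie in `A`, `edge⊈` excludes the other two. So `A`
  -- would fit into a singleton, although members have at least two elements.
  pair⊈triangle : ∀ {x y z} → x ~ y → x ~ z → y ~ z →
    A ∈ᶠ 𝒜 → ∣ A ∣ ≡ 2 → ¬ A ⊆ triple x y z
  pair⊈triangle {A} {x} {y} {z} x~y x~z y~z A∈ ∣A∣≡2 A⊆ with x ∈? A | y ∈? A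
  ... | yes x∈A | _ = ⊆-singleton⊥ A∈ λ u∈A → case-x u∈A (∈-triple⁻ (A⊆ u∈A))
    where
    case-x : ∀ {u} → u ∈ A → u ≡ x ⊎ u ≡ y ⊎ u ≡ z → u ∈ ⁅ x ⁆
    case-x u∈A (inj₁ refl) = x∈⁅x⁆ x
    case-x u∈A (inj₂ (inj₁ refl)) = ⊥-elim (edge⊈ x~y A∈ ∣A∣≡2 x∈A u∈A)
    case-x u∈A (inj₂ (inj₂ refl)) = ⊥-elim (edge⊈ x~z A∈ ∣A∣≡2 x∈A u∈A)
  ... | no x∉A | yes y∈A = ⊆-singleton⊥ A∈ λ u∈A → case-y u∈A (∈-triple⁻ (A⊆ u∈A))
    where
    case-y : ∀ {u} → u ∈ A → u ≡ x ⊎ u ≡ y ⊎ u ≡ z → u ∈ ⁅ y ⁆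
    case-y u∈A (inj₁ refl) = ⊥-elim (x∉A u∈A)
    case-y u∈A (inj₂ (inj₁ refl)) = x∈⁅x⁆ y
    case-y u∈A (inj₂ (inj₂ refl)) = ⊥-elim (edge⊈ y~z A∈ ∣A∣≡2 y∈A u∈A)
  ... | no x∉A | no y∉A = ⊆-singleton⊥ A∈ λ u∈A → case-z u∈A (∈-triple⁻ (A⊆ u∈A))
    where
    case-z : ∀ {u} → u ∈ A → u ≡ x ⊎ u ≡ y ⊎ u ≡ z → u ∈ ⁅ z ⁆
    case-z u∈A (inj₁ refl) = ⊥-elim (x∉A u∈A)
    case-z u∈A (inj₂ (inj₁ refl)) = ⊥-elim (y∉A u∈A)
    case-z u∈A (inj₂ (inj₂ refl)) = x∈⁅x⁆ z

  -- Otherwise maximality supplies a member comparable with the triple. A member above it, or a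
  -- 3-element member below it, equals it by size; a 2-element member below it is ruled out by
  -- `pair⊈triangle`.
  triangle∈𝒜 : ∀ {x y z} → x ~ y → x ~ z → y ~ z → triple x y z ∈ᶠ 𝒜
  triangle∈𝒜 {x} {y} {z} x~y x~z y~z =
    decidable-stable (triple x y z ∈ₗ? members 𝒜) λ T∉ → absurd T∉ (maximal _ T∉)
    where
    ∣T∣≡3 = ∣triple∣ (proj₁ x~y) (proj₁ x~z) (proj₁ y~z)
    absurd : triple x y z ∉ᶠ 𝒜 →
      ¬ (∃[ A ] A ∈ᶠ 𝒜 × (triple x y z ⊆ A ⊎ A ⊆ triple x y z))
    absurd T∉ (A , A∈ , inj₁ T⊆A) = T∉ (subst (_∈ᶠ 𝒜) (sym T≡A) A∈)
      where T≡A = ∣∣≤⇒≡ T⊆A (ℕₚ.≤-trans (∣∣≤3 A∈) (ℕₚ.≤-reflexive (sym ∣T∣≡3)))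
    absurd T∉ (A , A∈ , inj₂ A⊆T) with sizes A A∈
    ... | inj₁ ∣A∣≡2 = pair⊈triangle x~y x~z y~z A∈ ∣A∣≡2 A⊆T
    ... | inj₂ ∣A∣≡3 = T∉ (subst (_∈ᶠ 𝒜) A≡T A∈)
      where A≡T = ∣∣≤⇒≡ A⊆T (ℕₚ.≤-reflexive (trans ∣T∣≡3 (sym ∣A∣≡3)))

  pair-in-member⇒~ : ∀ {x y} → A ∈ᶠ 𝒜 → ∣ A ∣ ≡ 3 → x ∈ A → y ∈ A → x ≢ y → x ~ y
  pair-in-member⇒~ {A} {x} {y} A∈ ∣A∣≡3 x∈A y∈A x≢y =
    x≢y , λ xy∈ → antichain _ _ xy∈ A∈ pair≢A (pair⊆ x∈A y∈A)
    where
    pair≢A : pair x y ≢ A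
    pair≢A eq with () ← trans (sym (∣pair∣ x≢y)) (trans (cong ∣_∣ eq) ∣A∣≡3)

  -- Maximality supplies a member comparable with the pair. Sizes exclude all cases but a 3-element
  -- member containing it; the third point of that member is the required vertex, and the antichain
  -- condition makes its pairs edges.
  edge-in-triangle : ∀ {x y} → x ~ y → ∃[ z ] x ~ z × y ~ z
  edge-in-triangle {x} {y} (x≢y , xy∉) with maximal (pair x y) xy∉
  ... | A , A∈ , inj₂ A⊆ = ⊥-elim (xy∉ (subst (_∈ᶠ 𝒜) A≡pair A∈))
    where A≡pair = ∣∣≤⇒≡ A⊆ (ℕₚ.≤-trans (ℕₚ.≤-reflexive (∣pair∣ x≢y)) (2≤∣∣ A∈))
  ... | A , A∈ , inj₁ ⊆A with sizes A A∈
  ...   | inj₁ ∣A∣≡2 = ⊥-elim (edge⊈ (x≢y , xy∉) A∈ ∣A∣≡2 (⊆A x∈pair) (⊆A (y∈pair {x = x})))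
  ...   | inj₂ ∣A∣≡3 with Fin.any? (λ z → z ∈? A ×-dec ¬? (z ∈? pair x y))
  ...     | yes (z , z∈A , z∉) =
    z , pair-in-member⇒~ A∈ ∣A∣≡3 (⊆A x∈pair) z∈A (λ { refl → z∉ x∈pair })
      , pair-in-member⇒~ A∈ ∣A∣≡3 (⊆A (y∈pair {x = x})) z∈A (λ { refl → z∉ (y∈pair {x = x}) })
  ...     | no ∄z = ⊥-elim (ℕₚ.<⇒≱ (ℕₚ.n<1+n 2) (subst₂ ℕ._≤_ ∣A∣≡3 (∣pair∣ x≢y) (p⊆q⇒∣p∣≤∣q∣ A⊆)))
    where
    A⊆ : A ⊆ pair x y
    A⊆ {z} z∈A = decidable-stable (z ∈? pair x y) λ z∉ → ∄z (z , z∈A , z∉)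

  N : Fin n → Subset n
  N x = Vec.tabulate (does ∘ (x ~?_))

  ∈N⁺ : ∀ {x y} → x ~ y → y ∈ N x
  ∈N⁺ {x} {y} x~y = Vec.lookup⇒[]= y (N x)
    (trans (Vec.lookup∘tabulate _ y) (dec-true (x ~? y) x~y))

  ∈N⁻ : ∀ {x y} → y ∈ N x → x ~ y
  ∈N⁻ {x} {y} y∈N with x ~? y in eq
  ... | yes x~y = x~y
  ... | no _ with () ← trans (sym (Vec.[]=⇒lookup y∈N))
                         (trans (Vec.lookup∘tabulate (does ∘ (x ~?_)) y) (cong does eq))

  w : Fin n → Fin n → ℕ
  w x y = ∣ N x ∩ N y ∣

  -- This makes the truncated `pred (w x y)` a genuine w - 1 on edges.
  1≤w : ∀ {x y} → x ~ y → 1 ℕ.≤ w x y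
  1≤w {x} {y} x~y with z , x~z , y~z ← edge-in-triangle x~y =
    ℕₚ.≤-trans (ℕₚ.≤-reflexive (sym (∣⁅x⁆∣≡1 z)))
      (p⊆q⇒∣p∣≤∣q∣ λ u∈ → subst (_∈ N x ∩ N y) (sym (x∈⁅y⁆⇒x≡y z u∈))
        (x∈p∩q⁺ (∈N⁺ x~z , ∈N⁺ y~z)))

  w≡1+pred : ∀ {x y} → x ~ y → w x y ≡ ℕ.suc (pred (w x y))
  w≡1+pred {x} {y} x~y = sym (ℕₚ.suc-pred (w x y) {{ℕ.>-nonZero (1≤w x~y)}})

  -- Weighted counting in the star of a vertex

  star : Fin n → List (Subset n)
  star x = filter (x ∈?_) (members 𝒜)

  -- The weights 2 for pairs and 1 for triples make every member of the star of
  -- x contribute exactly 2 in total to the pairs (x , y).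
  weight : Fin n → Fin n → Subset n → ℕ
  weight x y A = χ (A ∖ x) y ℕ.* (4 ∸ ∣ A ∣)

  codegree : Fin n → Fin n → ℕ
  codegree x y = sum (map (weight x y) (star x))

  -- With `x` removed, a pair leaves one point of weight 2 and a triple leaves two points of weight
  -- 1.
  ∑-codegree≤ : ∀ x → ∑[ y < n ] codegree x y ℕ.≤ degree 𝒜 x ℕ.* 2
  ∑-codegree≤ x = subst (∑[ y < n ] codegree x y ℕ.≤_) (sum-const 2 (star x))
    (∑-sum-swap-≤ (weight x) (λ _ → 2) (star x) (tabulate total))
    where
    bound : ∀ A → A ∈ₗ star x → ∣ A ∖ x ∣ ℕ.* (4 ∸ ∣ A ∣) ℕ.≤ 2
    bound A A∈ with A∈𝒜 , x∈A ← ∈-filter⁻ (x ∈?_) {xs = members 𝒜} A∈ with sizes A A∈𝒜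
    ... | inj₁ eq rewrite eq = ℕₚ.*-monoˡ-≤ 2 (∣A∖x∣≤k x∈A eq)
    ... | inj₂ eq rewrite eq = ℕₚ.*-monoˡ-≤ 1 (∣A∖x∣≤k x∈A eq)
    total : ∀ {A} → A ∈ₗ star x → ∑[ y < n ] weight x y A ℕ.≤ 2
    total {A} A∈ = subst (ℕ._≤ 2)
      (trans (cong (ℕ._* (4 ∸ ∣ A ∣)) (sym (∑χ≡∣∣ (A ∖ x)))) (*-distribʳ-sum (4 ∸ ∣ A ∣) (χ (A ∖ x))))
      (bound A A∈)

  2≤codegree : ∀ {x y} → x ≢ y → ¬ x ~ y → 2 ℕ.≤ codegree x y
  2≤codegree {x} {y} x≢y x≁y =
    subst (ℕ._≤ codegree x y) weight≡2 (term≤sum (weight x y) (∈-filter⁺ (x ∈?_) pair∈ x∈pair))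
    where
    pair∈ : pair x y ∈ᶠ 𝒜
    pair∈ = decidable-stable (pair x y ∈ₗ? members 𝒜) λ xy∉ → x≁y (x≢y , xy∉)
    weight≡2 : weight x y (pair x y) ≡ 2
    weight≡2 rewrite χ-∈ (x∈p∧x≢y⇒x∈p-y (y∈pair {x = x}) (x≢y ∘ sym)) | ∣pair∣ x≢y = refl

  -- Each common neighbour `z` completes the edge to a triangle, which is a member through `x` and
  -- `y`. Counting incidences (z , A) replaces an argument that different `z` give different
  -- triples.
  w≤codegree : ∀ {x y} → x ~ y → w x y ℕ.≤ codegree x y
  w≤codegree {x} {y} x~y = begin
    w x y ≡⟨ ∑χ≡∣∣ (N x ∩ N y) ⟨
    ∑[ z < n ] χ (N x ∩ N y) z ≤⟨ ∑-mono-≤ _ _ common ⟩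
    ∑[ z < n ] sum (map (f z) (star x)) ≤⟨ ∑-sum-swap-≤ f (weight x y) (star x) (tabulate total) ⟩
    codegree x y ∎
    where
    open ℕₚ.≤-Reasoning
    -- The product indicates that `A` contains `y` and `z`, with `x`, `y` and `z` distinct.
    f : Fin n → Subset n → ℕ
    f z A = χ (A ∖ x) y ℕ.* χ (A ∖ x ∖ y) z
    common : ∀ z → χ (N x ∩ N y) z ℕ.≤ sum (map (f z) (star x))
    common z with z ∈? N x ∩ N y
    ... | no z∉ = ℕₚ.≤-trans (ℕₚ.≤-reflexive (χ-∉ z∉)) z≤n
    ... | yes z∈ with z∈Nx , z∈Ny ← x∈p∩q⁻ (N x) (N y) z∈ = ℕₚ.≤-trans
      (ℕₚ.≤-reflexive (trans (χ-∈ z∈) (sym f≡1)))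
      (term≤sum (f z) (∈-filter⁺ (x ∈?_) (triangle∈𝒜 x~y x~z y~z) x∈triple))
      where
      x~z = ∈N⁻ z∈Nx
      y~z = ∈N⁻ z∈Ny
      f≡1 : f z (triple x y z) ≡ 1
      f≡1 = cong₂ ℕ._*_
        (χ-∈ (x∈p∧x≢y⇒x∈p-y (y∈triple {x = x}) (proj₁ x~y ∘ sym)))
        (χ-∈ (x∈p∧x≢y⇒x∈p-y (x∈p∧x≢y⇒x∈p-y (z∈triple {x = x} {y}) (proj₁ x~z ∘ sym)) (proj₁ y~z ∘ sym)))
    -- A triple through `x` and `y` has one further point, matching its weight 1. For a pair a crude
    -- estimate is enough, since its weight is 2.
    bound : ∀ {A} → A ∈ₗ star x → y ∈ A ∖ x → ∣ A ∖ x ∖ y ∣ ℕ.≤ 4 ∸ ∣ A ∣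
    bound {A} A∈ y∈ with A∈𝒜 , x∈A ← ∈-filter⁻ (x ∈?_) {xs = members 𝒜} A∈ with sizes A A∈𝒜
    ... | inj₁ eq rewrite eq = ℕₚ.≤-trans (ℕₚ.<⇒≤ (x∈p⇒∣p-x∣<∣p∣ y∈))
            (ℕₚ.≤-trans (∣A∖x∣≤k x∈A eq) (s≤s z≤n))
    ... | inj₂ eq rewrite eq =
            ℕ.s≤s⁻¹ (ℕₚ.≤-trans (x∈p⇒∣p-x∣<∣p∣ y∈) (∣A∖x∣≤k x∈A eq))
    total : ∀ {A} → A ∈ₗ star x → ∑[ z < n ] f z A ℕ.≤ weight x y A
    total {A} A∈ = begin
      ∑[ z < n ] f z A ≡⟨ *-distribˡ-sum (χ (A ∖ x) y) (χ (A ∖ x ∖ y)) ⟨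
      χ (A ∖ x) y ℕ.* ∑ (χ (A ∖ x ∖ y)) ≡⟨ cong (χ (A ∖ x) y ℕ.*_) (∑χ≡∣∣ (A ∖ x ∖ y)) ⟩
      χ (A ∖ x) y ℕ.* ∣ A ∖ x ∖ y ∣ ≤⟨ scaled ⟩
      weight x y A ∎
      where
      scaled : χ (A ∖ x) y ℕ.* ∣ A ∖ x ∖ y ∣ ℕ.≤ weight x y A
      scaled with y ∈? A ∖ x
      ... | yes y∈ = ℕₚ.*-monoʳ-≤ (χ (A ∖ x) y) (bound A∈ y∈)
      ... | no y∉ rewrite χ-∉ y∉ = z≤n

  -- The indicator extends the sum of w - 1 over the neighbours of `x` to a sum over all points.
  excess : Fin n → Fin n → ℕ
  excess x y = χ (N x) y ℕ.* pred (w x y)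

  excess-~ : ∀ {x y} → x ~ y → excess x y ≡ pred (w x y)
  excess-~ x~y rewrite χ-∈ (∈N⁺ x~y) = ℕₚ.*-identityˡ _

  -- The bound of the overview with all subtractions moved across. The summand 2 on the right pays
  -- for the diagonal term y = x, and `∣ N x ∣` pays one unit for each neighbour.
  degree-bound : ∀ x → n ℕ.* 2 ℕ.+ ∑ (excess x) ℕ.≤ degree 𝒜 x ℕ.* 2 ℕ.+ 2 ℕ.+ ∣ N x ∣
  degree-bound x = begin
    n ℕ.* 2 ℕ.+ ∑ (excess x)
      ≡⟨ cong (ℕ._+ ∑ (excess x)) (∑-const n 2) ⟨
    ∑[ y < n ] 2 ℕ.+ ∑ (excess x)
      ≡⟨ ∑-distrib-+ {n} (λ _ → 2) (excess x) ⟨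
    ∑[ y < n ] (2 ℕ.+ excess x y)
      ≤⟨ ∑-mono-≤ _ _ pointwise ⟩
    ∑[ y < n ] (codegree x y ℕ.+ χ ⁅ x ⁆ y ℕ.* 2 ℕ.+ χ (N x) y)
      ≡⟨ trans (∑-distrib-+ {n} (λ y → codegree x y ℕ.+ χ ⁅ x ⁆ y ℕ.* 2) (χ (N x)))
           (cong (ℕ._+ ∑ (χ (N x))) (∑-distrib-+ (codegree x) (λ y → χ ⁅ x ⁆ y ℕ.* 2))) ⟩
    ∑ (codegree x) ℕ.+ ∑[ y < n ] (χ ⁅ x ⁆ y ℕ.* 2) ℕ.+ ∑ (χ (N x))
      ≡⟨ cong₂ (λ a b → ∑ (codegree x) ℕ.+ a ℕ.+ b)
           (trans (sym (*-distribʳ-sum 2 (χ ⁅ x ⁆)))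
             (cong (ℕ._* 2) (trans (∑χ≡∣∣ ⁅ x ⁆) (∣⁅x⁆∣≡1 x))))
           (∑χ≡∣∣ (N x)) ⟩
    ∑ (codegree x) ℕ.+ 2 ℕ.+ ∣ N x ∣
      ≤⟨ ℕₚ.+-monoˡ-≤ ∣ N x ∣ (ℕₚ.+-monoˡ-≤ 2 (∑-codegree≤ x)) ⟩
    degree 𝒜 x ℕ.* 2 ℕ.+ 2 ℕ.+ ∣ N x ∣ ∎
    where
    open ℕₚ.≤-Reasoning
    -- A neighbour needs 2 + (w - 1) = w + 1, that is, its codegree bound plus the unit from `N x`.
    -- A non-neighbour gets its 2 from the member `pair x y`, and `x` itself gets it from the
    -- singleton term.
    pointwise : ∀ y → 2 ℕ.+ excess x y ℕ.≤ codegree x y ℕ.+ χ ⁅ x ⁆ y ℕ.* 2 ℕ.+ χ (N x) y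
    pointwise y with x ~? y
    ... | yes x~y = begin
      2 ℕ.+ excess x y ≡⟨ cong (2 ℕ.+_) (excess-~ x~y) ⟩
      2 ℕ.+ pred (w x y) ≡⟨ cong ℕ.suc (w≡1+pred x~y) ⟨
      1 ℕ.+ w x y ≤⟨ s≤s (w≤codegree x~y) ⟩
      1 ℕ.+ codegree x y ≡⟨ ℕₚ.+-comm 1 (codegree x y) ⟩
      codegree x y ℕ.+ 1 ≤⟨ ℕₚ.+-monoˡ-≤ 1 (ℕₚ.m≤m+n (codegree x y) _) ⟩
      codegree x y ℕ.+ χ ⁅ x ⁆ y ℕ.* 2 ℕ.+ 1 ≡⟨ cong (codegree x y ℕ.+ χ ⁅ x ⁆ y ℕ.* 2 ℕ.+_) (χ-∈ (∈N⁺ x~y)) ⟨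
      codegree x y ℕ.+ χ ⁅ x ⁆ y ℕ.* 2 ℕ.+ χ (N x) y ∎
    ... | no x≁y rewrite χ-∉ (x≁y ∘ ∈N⁻) = ℕₚ.≤-trans 2≤ (ℕₚ.m≤m+n _ 0)
      where
      2≤ : 2 ℕ.≤ codegree x y ℕ.+ χ ⁅ x ⁆ y ℕ.* 2
      2≤ with x Fin.≟ y
      ... | yes refl rewrite χ-∈ (x∈⁅x⁆ x) = ℕₚ.m≤n+m 2 (codegree x x)
      ... | no x≢y = ℕₚ.≤-trans (2≤codegree x≢y x≁y) (ℕₚ.m≤m+n _ _)

  -- Adding the bounds over one triangle

  degree-bound-at-triangle : ∀ {x y z} → x ~ y → x ~ z → y ≢ z →
    n ℕ.* 2 ℕ.+ (pred (w x y) ℕ.+ pred (w x z)) ℕ.≤ degree 𝒜 x ℕ.* 2 ℕ.+ 2 ℕ.+ ∣ N x ∣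
  degree-bound-at-triangle {x} x~y x~z y≢z = ℕₚ.≤-trans
    -- Of the nonnegative excess terms only those of the two distinct neighbours `y` and `z` are
    -- kept.
    (ℕₚ.+-monoʳ-≤ (n ℕ.* 2)
      (subst (ℕ._≤ ∑ (excess x)) (cong₂ ℕ._+_ (excess-~ x~y) (excess-~ x~z))
        (two-terms≤∑ (excess x) y≢z)))
    (degree-bound x)

  w-comm : ∀ x y → w x y ≡ w y x
  w-comm x y = cong ∣_∣ (∩-comm (N x) (N y))

  regular-bound : ∀ k → Fin n → (∀ x → degree 𝒜 x ≡ k) → 5 ℕ.* n ℕ.≤ 6 ℕ.* k ℕ.+ 9
  regular-bound k x regular with Fin.any? (x ~?_)
  -- With no neighbours, `degree-bound` reads 2n ≤ 2k + 2; tripling it gives 6n ≤ 6k + 6, stronger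
  -- than the goal.
  ... | no isolated = ℕₚ.≤-trans (ℕₚ.m≤n+m (5 ℕ.* n) n) (begin
    n ℕ.+ 5 ℕ.* n ≡⟨ 6n≡ n ⟩
    (n ℕ.* 2) ℕ.* 3 ≤⟨ ℕₚ.*-monoˡ-≤ 3 2n≤ ⟩
    (k ℕ.* 2 ℕ.+ 2 ℕ.+ 0) ℕ.* 3 ≡⟨ 6k+6≡ k ⟩
    6 ℕ.* k ℕ.+ 6 ≤⟨ ℕₚ.+-monoʳ-≤ (6 ℕ.* k) (ℕₚ.m≤m+n 6 3) ⟩
    6 ℕ.* k ℕ.+ 9 ∎)
    where
    open ℕₚ.≤-Reasoning
    ∣Nx∣≡0 : ∣ N x ∣ ≡ 0
    ∣Nx∣≡0 = trans (cong ∣_∣ (Empty-unique λ (y , y∈) → isolated (y , ∈N⁻ y∈))) (∣⊥∣≡0 n)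
    2n≤ : n ℕ.* 2 ℕ.≤ k ℕ.* 2 ℕ.+ 2 ℕ.+ 0
    2n≤ = subst₂ (λ d m → n ℕ.* 2 ℕ.≤ d ℕ.* 2 ℕ.+ 2 ℕ.+ m) (regular x) ∣Nx∣≡0
      (ℕₚ.≤-trans (ℕₚ.m≤m+n (n ℕ.* 2) _) (degree-bound x))
    6n≡ : ∀ n → n ℕ.+ 5 ℕ.* n ≡ (n ℕ.* 2) ℕ.* 3
    6n≡ = solve-∀
    6k+6≡ : ∀ k → (k ℕ.* 2 ℕ.+ 2 ℕ.+ 0) ℕ.* 3 ≡ 6 ℕ.* k ℕ.+ 6
    6k+6≡ = solve-∀
  ... | yes (y , x~y) with z , x~z , y~z ← edge-in-triangle x~y =
    -- The padding turns 5n into 6n + 2(a + b + c), the total of the three left-hand sides, and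
    -- avoids subtraction.
    ℕₚ.+-cancelʳ-≤ (n ℕ.+ (a ℕ.+ b ℕ.+ c) ℕ.* 2) _ _ (begin
      5 ℕ.* n ℕ.+ (n ℕ.+ (a ℕ.+ b ℕ.+ c) ℕ.* 2)
        ≡⟨ lhs≡ n a b c ⟩
      (n ℕ.* 2 ℕ.+ (a ℕ.+ b)) ℕ.+ (n ℕ.* 2 ℕ.+ (a ℕ.+ c)) ℕ.+ (n ℕ.* 2 ℕ.+ (b ℕ.+ c))
        ≤⟨ ℕₚ.+-mono-≤ (ℕₚ.+-mono-≤ at-x at-y) at-z ⟩
      (k ℕ.* 2 ℕ.+ 2 ℕ.+ ∣ N x ∣) ℕ.+ (k ℕ.* 2 ℕ.+ 2 ℕ.+ ∣ N y ∣) ℕ.+ (k ℕ.* 2 ℕ.+ 2 ℕ.+ ∣ N z ∣)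
        ≡⟨ mid≡ k (∣ N x ∣) (∣ N y ∣) (∣ N z ∣) ⟩
      6 ℕ.* k ℕ.+ 6 ℕ.+ (∣ N x ∣ ℕ.+ ∣ N y ∣ ℕ.+ ∣ N z ∣)
        ≤⟨ ℕₚ.+-monoʳ-≤ (6 ℕ.* k ℕ.+ 6) (three-sets-bound (N x) (N y) (N z)) ⟩
      6 ℕ.* k ℕ.+ 6 ℕ.+ (n ℕ.+ (w x y ℕ.+ w x z ℕ.+ w y z))
        ≡⟨ cong (λ m → 6 ℕ.* k ℕ.+ 6 ℕ.+ (n ℕ.+ m))
             -- Each of the three edges has w = 1 + `pred` w; these three units raise the constant
             -- from 6 to 9.
             (cong₂ ℕ._+_ (cong₂ ℕ._+_ (w≡1+pred x~y) (w≡1+pred x~z)) (w≡1+pred y~z)) ⟩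
      6 ℕ.* k ℕ.+ 6 ℕ.+ (n ℕ.+ (ℕ.suc a ℕ.+ ℕ.suc b ℕ.+ ℕ.suc c))
        -- The degree bounds supply a + b + c twice on the left, while the three-set bound costs it
        -- only once; the surplus copy is given away here.
        ≤⟨ ℕₚ.m≤m+n _ (a ℕ.+ b ℕ.+ c) ⟩
      6 ℕ.* k ℕ.+ 6 ℕ.+ (n ℕ.+ (ℕ.suc a ℕ.+ ℕ.suc b ℕ.+ ℕ.suc c)) ℕ.+ (a ℕ.+ b ℕ.+ c)
        ≡⟨ rhs≡ n k a b c ⟩
      6 ℕ.* k ℕ.+ 9 ℕ.+ (n ℕ.+ (a ℕ.+ b ℕ.+ c) ℕ.* 2) ∎)
    where
    open ℕₚ.≤-Reasoning
    a = pred (w x y)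
    b = pred (w x z)
    c = pred (w y z)
    at : ∀ {u v t} → u ~ v → u ~ t → v ≢ t →
      n ℕ.* 2 ℕ.+ (pred (w u v) ℕ.+ pred (w u t)) ℕ.≤ k ℕ.* 2 ℕ.+ 2 ℕ.+ ∣ N u ∣
    at {u} u~v u~t v≢t = subst (λ d → _ ℕ.≤ d ℕ.* 2 ℕ.+ 2 ℕ.+ ∣ N u ∣) (regular u)
      (degree-bound-at-triangle u~v u~t v≢t)
    at-x : n ℕ.* 2 ℕ.+ (a ℕ.+ b) ℕ.≤ k ℕ.* 2 ℕ.+ 2 ℕ.+ ∣ N x ∣
    at-x = at x~y x~z (proj₁ y~z)
    at-y : n ℕ.* 2 ℕ.+ (a ℕ.+ c) ℕ.≤ k ℕ.* 2 ℕ.+ 2 ℕ.+ ∣ N y ∣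
    at-y rewrite w-comm x y = at (~-sym x~y) y~z (proj₁ x~z)
    at-z : n ℕ.* 2 ℕ.+ (b ℕ.+ c) ℕ.≤ k ℕ.* 2 ℕ.+ 2 ℕ.+ ∣ N z ∣
    at-z rewrite w-comm x z | w-comm y z = at (~-sym x~z) (~-sym y~z) (proj₁ x~y)
    lhs≡ : ∀ n a b c → 5 ℕ.* n ℕ.+ (n ℕ.+ (a ℕ.+ b ℕ.+ c) ℕ.* 2) ≡
      (n ℕ.* 2 ℕ.+ (a ℕ.+ b)) ℕ.+ (n ℕ.* 2 ℕ.+ (a ℕ.+ c)) ℕ.+ (n ℕ.* 2 ℕ.+ (b ℕ.+ c))
    lhs≡ = solve-∀
    mid≡ : ∀ k p q s →
      (k ℕ.* 2 ℕ.+ 2 ℕ.+ p) ℕ.+ (k ℕ.* 2 ℕ.+ 2 ℕ.+ q) ℕ.+ (k ℕ.* 2 ℕ.+ 2 ℕ.+ s) ≡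
      6 ℕ.* k ℕ.+ 6 ℕ.+ (p ℕ.+ q ℕ.+ s)
    mid≡ = solve-∀
    rhs≡ : ∀ n k a b c →
      6 ℕ.* k ℕ.+ 6 ℕ.+ (n ℕ.+ (ℕ.suc a ℕ.+ ℕ.suc b ℕ.+ ℕ.suc c)) ℕ.+ (a ℕ.+ b ℕ.+ c) ≡
      6 ℕ.* k ℕ.+ 9 ℕ.+ (n ℕ.+ (a ℕ.+ b ℕ.+ c) ℕ.* 2)
    rhs≡ = solve-∀

-- Passage to integers and rationals

/-mono-≤ : ∀ p q a b → p * + ℕ.suc b ℤ.≤ q * + ℕ.suc a → q / ℕ.suc b ≥ p / ℕ.suc a
-- `_/_` reduces to lowest terms, so the comparison is made on unnormalised fractions, where it is
-- cross-multiplication.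
/-mono-≤ p q a b p≤q = ℚₚ.toℚᵘ-cancel-≤ (begin
  ℚ.toℚᵘ (p / ℕ.suc a) ≃⟨ ℚₚ.toℚᵘ-fromℚᵘ (ℚᵘ.mkℚᵘ p a) ⟩
  ℚᵘ.mkℚᵘ p a ≤⟨ ℚᵘ.*≤* p≤q ⟩
  ℚᵘ.mkℚᵘ q b ≃⟨ ℚₚ.toℚᵘ-fromℚᵘ (ℚᵘ.mkℚᵘ q b) ⟨
  ℚ.toℚᵘ (q / ℕ.suc b) ∎)
  where open ℚᵘₚ.≤-Reasoning

corollary2 : (n : ℕ) (r : ℤ) → n ≥ℕ 3 →
    (∃[ 𝒜 ] (IsMaximal23Antichain {n} 𝒜 × IsRegular r 𝒜)) →
    r / 1 ≥ (+ 5 * + n - + 9) / 6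
-- As n is positive, the point `zero` exists; its degree `k` is a natural number whose integer value
-- is `r`.
corollary2 n@(ℕ.suc _) r n≥3 (𝒜 , maximal , regular) =
  -- The arguments 5 and 0 are the predecessors of the denominators 6 and 1.
  /-mono-≤ (+ 5 * + n - + 9) r 5 0 (begin
    (+ 5 * + n - + 9) * + 1 ≡⟨ ℤₚ.*-identityʳ _ ⟩
    + 5 * + n - + 9 ≡⟨ cong (_- + 9) (ℤₚ.pos-* 5 n) ⟨
    + (5 ℕ.* n) - + 9 ≤⟨ ℤₚ.+-monoˡ-≤ (ℤ.- + 9) (ℤ.+≤+ bound) ⟩
    + (6 ℕ.* k ℕ.+ 9) - + 9 ≡⟨ ℤₚ.+-assoc (+ (6 ℕ.* k)) (+ 9) (ℤ.- + 9) ⟩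
    + (6 ℕ.* k) ℤ.+ + 0 ≡⟨ ℤₚ.+-identityʳ _ ⟩
    + (6 ℕ.* k) ≡⟨ cong +_ (ℕₚ.*-comm 6 k) ⟩
    + (k ℕ.* 6) ≡⟨ ℤₚ.pos-* k 6 ⟩
    + k * + 6 ≡⟨ cong (_* + 6) (regular zero) ⟩
    r * + 6 ∎)
  where
  open ℤₚ.≤-Reasoning
  k = degree 𝒜 zero
  bound : 5 ℕ.* n ℕ.≤ 6 ℕ.* k ℕ.+ 9
  bound = EdgeGraph.regular-bound 𝒜 maximal k zero λ x →
    ℤₚ.+-injective (trans (regular x) (sym (regular zero)))
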